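{- Let $S$ be a recurrent specular set on the finite alphabet $A$ (so $A\subset S$). For any $w\in S$ such that $w\neq w^{ -1}$, the set of complete return words to $\{w,w^{ -1}\}$ in $S$ has $\mathrm{Card}(A)$ elements.
   Context: Words are over a finite alphabet $A$; $\varepsilon$ is the empty word. A set $S$ of words on $A$ is factorial if it contains $A$ and all the factors of its elements. For $w\in S$ let $L(w)=\{a\in A\mid aw\in S\}$, $R(w)=\{a\in A\mid wa\in S\}$, $B(w)=\{(a,b)\in A\times A\mid awb\in S\}$. A factorial set $S$ is biextendable if $B(w)\neq\emptyset$ for all $w\in S$. The extension graph $\mathcal{E}(w)$ is the undirected graph whose vertex set is the disjoint union of $L(w)$ and $R(w)$ and whose edges are the pairs in $B(w)$. A biextendable set $S$ is a tree set of characteristic $c$ if $\mathcal{E}(w)$ is a tree for every nonempty $w\in S$ and $\mathcal{E}(\varepsilon)$ is a disjoint union of $c$ trees. Let $\theta$ be an involution on $A$ (possibly with fixed points) and let $G_\theta$ be the group generated by $A$ with relations $a\theta(a)=1$, $a\in A$ (so $a^{ -1}=\theta(a)$). A word is reduced if it has no factor $a\theta(a)$ with $a\in A$; the inverse $w^{ -1}$ of a reduced word $w=a_1\cdots a_n$ is the reduced word $\theta(a_n)\cdots\theta(a_1)$. A laminary set on $A$ relative to $\theta$ is a biextendable set of reduced words closed under taking inverses. A specular set is a laminary set which is a tree set of characteristic $2$. A set $S\ne\{\varepsilon\}$ is recurrent if it is factorial and for all $u,w\in S$ there is $v\in S$ with $uvw\in S$. For a set $X\subset S$ of nonempty words, a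 complete return word to $X$ is a word of $S$ with a proper prefix in $X$, a proper suffix in $X$ but no internal factor in $X$ ($v$ is an internal factor of $y$ if $y=uvw$ with $u,w$ nonempty). -}

module Defs where

open import Data.Empty using (⊥)
open import Data.Fin using (Fin)
open import Data.List using (List; []; _∷_; _++_; _∷ʳ_; [_]; length; map; reverse)
open import Data.List.Properties using (++-identityʳ)
open import Data.List.Membership.Propositional using (_∈_)
open import Data.List.Relation.Unary.Linked using (Linked)
open import Data.List.Relation.Unary.Unique.Propositional using (Unique)
open import Data.Nat using (ℕ; _≤_)
open import Data.Product using (∃-syntax; _×_; _,_)
open import Data.Sum using (_⊎_; inj₁; inj₂)
open import Function.Bundles using (_⇔_)
open import Level using (0ℓ)
open import Relation.Binary.Construct.Closure.ReflexiveTransitive using (Star)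
open import Relation.Binary.PropositionalEquality using (_≡_; _≢_; refl; sym; cong)
open import Relation.Nullary using (¬_)
open import Relation.Unary using (Pred; _≐_; ｛_｝; Satisfiable)

-- Vertices are a predicate on an ambient type, rather than a type, so that
-- distinct proofs of vertexhood do not give distinct vertices.
record Graph (U : Set) : Set₁ where
  field
    Vertex        : Pred U 0ℓ
    Edge          : U → U → Set
    edge-source   : ∀ {u v} → Edge u v → Vertex u
    edge-sym      : ∀ {u v} → Edge u v → Edge v u
    edge-loopless : ∀ {u} → ¬ Edge u u

module _ {U : Set} where

  Connected : Graph U → Set
  Connected G = ∀ u v → Vertex u → Vertex v → Star Edge u v
    where open Graph G

  -- A cycle v, v₁, …, vₘ, v with m ≥ 2 and v, v₁, …, vₘ pairwise distinct.
  Cycle : Graph U → Set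
  Cycle G = ∃[ v ] ∃[ vs ] Unique (v ∷ vs) × 2 ≤ length vs × Linked Edge (v ∷ (vs ∷ʳ v))
    where open Graph G

  record IsTree (G : Graph U) : Set where
    field
      nonempty  : Satisfiable (Graph.Vertex G)
      connected : Connected G
      acyclic   : ¬ Cycle G

  record IsDisjointUnionOfTrees (c : ℕ) (G : Graph U) : Set₁ where
    field
      component : Fin c → Graph U
      tree      : ∀ i → IsTree (component i)
      disjoint  : ∀ {i j u} → Graph.Vertex (component i) u → Graph.Vertex (component j) u → i ≡ j
      vertices  : ∀ u → Graph.Vertex G u ⇔ (∃[ i ] Graph.Vertex (component i) u)
      edges     : ∀ u v → Graph.Edge G u v ⇔ (∃[ i ] Graph.Edge (component i) u v)

Word : Set → Set
Word A = List A

Language : Set → Set₁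
Language A = Pred (Word A) 0ℓ

module _ {A : Set} where

  Factor : Word A → Word A → Set
  Factor v y = ∃[ u ] ∃[ w ] y ≡ u ++ v ++ w

  InternalFactor : Word A → Word A → Set
  InternalFactor v y = ∃[ u ] ∃[ w ] u ≢ [] × w ≢ [] × y ≡ u ++ v ++ w

  ProperPrefix : Word A → Word A → Set
  ProperPrefix p y = ∃[ u ] u ≢ [] × y ≡ p ++ u

  ProperSuffix : Word A → Word A → Set
  ProperSuffix s y = ∃[ u ] u ≢ [] × y ≡ u ++ s

  record Factorial (S : Language A) : Set where
    field
      letters : ∀ a → S [ a ]
      factors : ∀ {v y} → Factor v y → S y → S v

  L : Language A → Word A → Pred A 0ℓ
  L S w a = S (a ∷ w)

  R : Language A → Word A → Pred A 0ℓ
  R S w a = S (w ∷ʳ a)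

  B : Language A → Word A → Pred (A × A) 0ℓ
  B S w (a , b) = S (a ∷ (w ∷ʳ b))

  record Biextendable (S : Language A) : Set where
    field
      factorial : Factorial S
      extend    : ∀ {w} → S w → Satisfiable (B S w)

  -- inj₁ a is the copy of a in L(w), inj₂ b the copy of b in R(w).
  extensionGraph : {S : Language A} → Factorial S → Word A → Graph (A ⊎ A)
  extensionGraph {S} F w = record
    { Vertex        = V
    ; Edge          = E
    ; edge-source   = λ {u} {v} → source u v
    ; edge-sym      = λ {u} {v} → symm u v
    ; edge-loopless = λ {u} → loopless u
    }
    where
    open Factorial F

    V : A ⊎ A → Set
    V (inj₁ a) = L S w a
    V (inj₂ b) = R S w b

    E : A ⊎ A → A ⊎ A → Set
    E (inj₁ a) (inj₂ b) = B S w (a , b)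
    E (inj₂ b) (inj₁ a) = B S w (a , b)
    E (inj₁ _) (inj₁ _) = ⊥
    E (inj₂ _) (inj₂ _) = ⊥

    source : ∀ u v → E u v → V u
    source (inj₁ a) (inj₂ b) = factors ([] , [ b ] , refl)
    source (inj₂ b) (inj₁ a) = factors ([ a ] , [] , cong (a ∷_) (sym (++-identityʳ (w ∷ʳ b))))
    source (inj₁ _) (inj₁ _) ()
    source (inj₂ _) (inj₂ _) ()

    symm : ∀ u v → E u v → E v u
    symm (inj₁ _) (inj₂ _) e = e
    symm (inj₂ _) (inj₁ _) e = e
    symm (inj₁ _) (inj₁ _) ()
    symm (inj₂ _) (inj₂ _) ()

    loopless : ∀ u → ¬ E u u
    loopless (inj₁ _) ()
    loopless (inj₂ _) ()

  record TreeSet (c : ℕ) (S : Language A) : Set₁ where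
    field
      biextendable : Biextendable S
    open Biextendable biextendable public
    field
      tree-nonempty : ∀ {w} → S w → w ≢ [] → IsTree (extensionGraph factorial w)
      tree-empty    : IsDisjointUnionOfTrees c (extensionGraph factorial [])

  Reduced : (A → A) → Word A → Set
  Reduced θ w = ∀ a → ¬ Factor (a ∷ θ a ∷ []) w

  inverse : (A → A) → Word A → Word A
  inverse θ w = reverse (map θ w)

  record Laminary (θ : A → A) (S : Language A) : Set where
    field
      biextendable   : Biextendable S
      reduced        : ∀ {w} → S w → Reduced θ w
      inverse-closed : ∀ {w} → S w → S (inverse θ w)

  record Specular (θ : A → A) (S : Language A) : Set₁ where
    field
      laminary : Laminary θ S
      treeSet  : TreeSet 2 S

  record Recurrent (S : Language A) : Set where
    field
      nontrivial : ¬ (S ≐ ｛ [] ｝)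
      factorial  : Factorial S
      recur      : ∀ {u w} → S u → S w → ∃[ v ] S v × S (u ++ v ++ w)

  record CompleteReturnWord (S X : Language A) (y : Word A) : Set where
    field
      member      : S y
      prefix      : ∃[ x ] X x × ProperPrefix x y
      suffix      : ∃[ x ] X x × ProperSuffix x y
      no-internal : ∀ {x} → X x → ¬ InternalFactor x y

-- Stated by a duplicate-free enumeration instead of a bijection with Σ B P,
-- since P may have several proofs at the same point.
HasCardinality : {B : Set} → Pred B 0ℓ → ℕ → Set
HasCardinality P n = ∃[ xs ] Unique xs × length xs ≡ n × (∀ y → y ∈ xs ⇔ P y)

{-# OPTIONS --safe #-}
module Submission where

-- For v in S let ρ(v) = Card R(v) − 1. Since a tree has one more vertex than edges, ρ(v) is the sum of
-- the ρ(av) over all letters a when v is nonempty, and the weights of the letters add up to k − 2.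
-- Let X be a set of c words of S of the same length. The complete return words to X are the leaves of
-- the forest, ordered by right extension, whose inner nodes are the words U of S meeting X exactly once,
-- as a prefix; the roots are the elements of X, so there are c + Σ_{u ∈ U} ρ(u) leaves. Every long word
-- of S has exactly one suffix in U, so left additivity of ρ gives Σ_{u ∈ U} ρ(u) = k − 2.
-- Finiteness of U: only finitely many u ∈ U have ρ(u) > 0, and beyond them right extensions are forced,
-- hence by recurrence they run into X.
-- Membership in S is decidable: in a tree two vertices are adjacent exactly when the simple path joining
-- them has length one.

open import Defs
open import Data.Empty using (⊥-elim)
open import Data.Fin as Fin using (Fin)
import Data.Fin.Properties as Fin
open import Data.List using (List; []; _∷_; _++_; _∷ʳ_; [_]; length; map; filter; cartesianProductWith; cartesianProduct; initLast; _∷ʳ′_; take; drop; allFin)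
open import Data.List.Membership.Propositional using (_∈_; _∉_)
open import Data.List.Membership.Propositional.Properties using (∈-filter⁺; ∈-filter⁻; ∈-cartesianProduct⁺; ∈-++⁺ˡ; ∈-++⁺ʳ; ∈-map⁺; ∈-map⁻; ∈-++⁻; ∈-cartesianProductWith⁺; ∈-cartesianProductWith⁻; ∈-allFin)
open import Data.List.Membership.Propositional.Properties.WithK using (unique∧set⇒bag)
open import Data.List.Properties using (length-map; map-++; map-∘; length-++; ++-identityʳ; ++-assoc; length-take; ∷-injective; ∷-injectiveʳ; ∷ʳ-injectiveˡ; ∷ʳ-++; take++drop≡id; ≡-dec; length-tabulate; length-reverse)
open import Data.List.Relation.Binary.BagAndSetEquality using (∼bag⇒↭)
open import Data.List.Relation.Binary.Permutation.Propositional.Properties using (↭-length)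
open import Data.List.Relation.Binary.Subset.Propositional using (_⊆_)
open import Data.List.Relation.Unary.All as All using (All; []; _∷_)
open import Data.List.Relation.Unary.All.Properties using (¬Any⇒All¬; All¬⇒¬Any; ∷ʳ⁺)
open import Data.List.Relation.Unary.AllPairs using ([]; _∷_)
open import Data.List.Relation.Unary.Any using (here; there)
open import Data.List.Relation.Unary.Linked using (Linked; [-]; _∷_)
open import Data.List.Relation.Unary.Unique.Propositional using (Unique)
open import Data.List.Relation.Unary.Unique.Propositional.Properties using (filter⁺; cartesianProduct⁺; ++⁺; map⁺; cartesianProductWith⁺; allFin⁺)
open import Data.Nat using (ℕ; zero; suc; _+_; _*_; _∸_; _≤_; _<_; z≤n; s≤s; _⊔_)
open import Data.Nat.ListAction using (sum)
open import Data.Nat.ListAction.Properties using (sum-++)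
open import Data.Nat.Properties
open import Algebra.Properties.CommutativeSemigroup +-commutativeSemigroup using (interchange; x∙yz≈y∙xz)
open import Data.Product using (∃-syntax; _×_; _,_; proj₁; proj₂; uncurry)
open import Data.Sum using (_⊎_; inj₁; inj₂; [_,_]′)
open import Data.Sum.Properties using (inj₁-injective; inj₂-injective) renaming (≡-dec to ⊎-≡-dec)
open import Function using (_∘_; id)
open import Function.Bundles using (_⇔_; mk⇔; Equivalence; _↔_; Inverse)
open import Function.Properties.Inverse using (↔⇒↣)
open import Level using (0ℓ)
open import Relation.Binary.Construct.Closure.ReflexiveTransitive using (Star; ε; _◅_)
open import Relation.Binary.Definitions using (DecidableEquality)
open import Relation.Binary.PropositionalEquality using (_≡_; _≢_; refl; sym; trans; cong; cong₂; subst; module ≡-Reasoning)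
open import Relation.Nullary using (¬_; Dec; yes; no)
open import Relation.Nullary.Decidable using (map′; ¬?; _×-dec_; _⊎-dec_; via-injection)
open import Relation.Unary using (Pred; Decidable; _∪_; ｛_｝)

open Equivalence using (to; from)

-- Finite sums and indicator functions.

module _ {B : Set} where

  ∑ : List B → (B → ℕ) → ℕ
  ∑ xs f = sum (map f xs)

  ∑-cong : ∀ {f g} xs → (∀ {x} → x ∈ xs → f x ≡ g x) → ∑ xs f ≡ ∑ xs g
  ∑-cong []       eq = refl
  ∑-cong (x ∷ xs) eq = cong₂ _+_ (eq (here refl)) (∑-cong xs (eq ∘ there))

  ∑-+ : ∀ xs (f g : B → ℕ) → ∑ xs (λ x → f x + g x) ≡ ∑ xs f + ∑ xs g
  ∑-+ []       f g = refl
  ∑-+ (x ∷ xs) f g = trans (cong (f x + g x +_) (∑-+ xs f g)) (interchange (f x) (g x) (∑ xs f) (∑ xs g))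

  ∑-* : ∀ xs n (f : B → ℕ) → ∑ xs (λ x → n * f x) ≡ n * ∑ xs f
  ∑-* []       n f = sym (*-zeroʳ n)
  ∑-* (x ∷ xs) n f = trans (cong (n * f x +_) (∑-* xs n f)) (sym (*-distribˡ-+ n (f x) (∑ xs f)))

  ∑-zero : ∀ xs → ∑ xs (λ _ → 0) ≡ 0
  ∑-zero []       = refl
  ∑-zero (_ ∷ xs) = ∑-zero xs

  ∑-one : ∀ xs → ∑ xs (λ _ → 1) ≡ length xs
  ∑-one []       = refl
  ∑-one (_ ∷ xs) = cong suc (∑-one xs)

  ∑-++ : ∀ xs ys (f : B → ℕ) → ∑ (xs ++ ys) f ≡ ∑ xs f + ∑ ys f
  ∑-++ xs ys f = trans (cong sum (map-++ f xs ys)) (sum-++ (map f xs) (map f ys))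

  ∑≡0⇒≡0 : ∀ {xs f x} → ∑ xs f ≡ 0 → x ∈ xs → f x ≡ 0
  ∑≡0⇒≡0 {y ∷ xs} {f} eq (here refl) = m+n≡0⇒m≡0 (f y) eq
  ∑≡0⇒≡0 {y ∷ xs} {f} eq (there x∈)  = ∑≡0⇒≡0 (m+n≡0⇒n≡0 (f y) eq) x∈

module _ {B C : Set} where

  ∑-map : ∀ (h : B → C) xs f → ∑ (map h xs) f ≡ ∑ xs (f ∘ h)
  ∑-map h xs f = cong sum (sym (map-∘ xs))

  ∑-swap : ∀ xs ys (f : B → C → ℕ) →
           ∑ xs (λ x → ∑ ys (f x)) ≡ ∑ ys (λ y → ∑ xs (λ x → f x y))
  ∑-swap []       ys f = sym (∑-zero ys)
  ∑-swap (x ∷ xs) ys f = trans (cong (∑ ys (f x) +_) (∑-swap xs ys f))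
                               (sym (∑-+ ys (f x) (λ y → ∑ xs (λ x → f x y))))

module _ {B C D : Set} where

  ∑-cartesianProductWith : ∀ (h : B → C → D) xs ys f →
    ∑ (cartesianProductWith h xs ys) f ≡ ∑ xs (λ x → ∑ ys (λ y → f (h x y)))
  ∑-cartesianProductWith h []       ys f = refl
  ∑-cartesianProductWith h (x ∷ xs) ys f =
    trans (∑-++ (map (h x) ys) _ f)
          (cong₂ _+_ (∑-map (h x) ys f) (∑-cartesianProductWith h xs ys f))

χ : ∀ {P : Set} → Dec P → ℕ
χ (yes _) = 1
χ (no _)  = 0

module _ {P : Set} where

  χ-true : (P? : Dec P) → P → χ P? ≡ 1
  χ-true (yes _) p = refl
  χ-true (no ¬p) p = ⊥-elim (¬p p)

  χ-false : (P? : Dec P) → ¬ P → χ P? ≡ 0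
  χ-false (yes p) ¬p = ⊥-elim (¬p p)
  χ-false (no _)  ¬p = refl

module _ {P Q : Set} where

  χ-⇔ : (P? : Dec P) (Q? : Dec Q) → (P → Q) → (Q → P) → χ P? ≡ χ Q?
  χ-⇔ (yes p) Q? f g = sym (χ-true Q? (f p))
  χ-⇔ (no ¬p) Q? f g = sym (χ-false Q? (¬p ∘ g))

  χ-⊎ : ∀ {R : Set} (P? : Dec P) (Q? : Dec Q) (R? : Dec R) →
        P ⇔ (Q ⊎ R) → ¬ (Q × R) → χ P? ≡ χ Q? + χ R?
  χ-⊎ P? (yes q) (yes r) eq disj = ⊥-elim (disj (q , r))
  χ-⊎ P? (yes q) (no _)  eq disj = χ-true P? (from eq (inj₁ q))
  χ-⊎ P? (no _)  (yes r) eq disj = χ-true P? (from eq (inj₂ r))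
  χ-⊎ P? (no ¬q) (no ¬r) eq disj = χ-false P? ([ ¬q , ¬r ]′ ∘ to eq)

module _ {B : Set} {P : Pred B 0ℓ} (P? : Decidable P) where

  length-filter-∑ : ∀ xs → length (filter P? xs) ≡ ∑ xs (χ ∘ P?)
  length-filter-∑ []       = refl
  length-filter-∑ (x ∷ xs) with P? x
  ... | yes _ = cong suc (length-filter-∑ xs)
  ... | no _  = length-filter-∑ xs

  -- Two duplicate-free lists with the same elements are permutations of each other, so their
  -- lengths agree.
  ∑-χ : ∀ {n} xs → Unique xs → (∀ {x} → P x → x ∈ xs) → HasCardinality P n → ∑ xs (χ ∘ P?) ≡ n
  ∑-χ xs xs! P⊆xs (ys , ys! , refl , ys⇔P) =
    trans (sym (length-filter-∑ xs))
      (↭-length (∼bag⇒↭ (unique∧set⇒bag (filter⁺ P? xs!) ys! (mk⇔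
        (λ x∈ → from (ys⇔P _) (proj₂ (∈-filter⁻ P? {xs = xs} x∈)))
        (λ x∈ → let p = to (ys⇔P _) x∈ in ∈-filter⁺ P? (P⊆xs p) p)))))

-- Simple paths, adjacency and edge counts in trees.

module _ {U : Set} (_≟_ : DecidableEquality U) (G : Graph U) where

  open Graph G
  open import Data.List.Membership.DecPropositional _≟_ using (_∈?_)

  -- The start vertex is left out of the list, so that `Unique (x ∷ vs)` expresses simplicity in the
  -- shape that `Cycle` asks for.
  data Path : U → List U → U → Set where
    stop : ∀ {x} → Path x [] x
    step : ∀ {x y vs z} → Edge x y → Path y vs z → Path x (y ∷ vs) z

  star⇒path : ∀ {x y} → Star Edge x y → ∃[ vs ] Path x vs y
  star⇒path ε       = [] , stop
  star⇒path (e ◅ s) = let vs , p = star⇒path s in _ , step e p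

  path-snoc : ∀ {x vs y z} → Path x vs y → Edge y z → Path x (vs ∷ʳ z) z
  path-snoc stop       e = step e stop
  path-snoc (step d p) e = step d (path-snoc p e)

  path-linked : ∀ {x vs y z} → Path x vs y → Edge y z → Linked Edge (x ∷ (vs ∷ʳ z))
  path-linked stop       e = e ∷ [-]
  path-linked (step d p) e = d ∷ path-linked p e

  path-from : ∀ {x y vs z} → x ∈ y ∷ vs → Path y vs z → Unique (y ∷ vs) →
              ∃[ us ] Path x us z × Unique (x ∷ us) × us ⊆ vs
  path-from (here refl) p          vs!      = _ , p , vs! , id
  path-from (there x∈)  (step _ p) (_ ∷ vs!) =
    let us , q , us! , us⊆ = path-from x∈ p vs! in us , q , us! , there ∘ us⊆

  -- If the start vertex recurs later, the path is cut to begin at that recurrence. The inclusion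
  -- `us ⊆ vs` keeps the result inside any set that contains the original vertices.
  erase-loops : ∀ {x vs z} → Path x vs z → ∃[ us ] Path x us z × Unique (x ∷ us) × us ⊆ vs
  erase-loops stop = [] , stop , [] ∷ [] , id
  erase-loops {x} (step {y = y} e p) with erase-loops p
  ... | us , q , us! , us⊆ with x ∈? (y ∷ us)
  ...   | yes x∈ = let ts , r , ts! , ts⊆ = path-from x∈ q us! in ts , r , ts! , there ∘ us⊆ ∘ ts⊆
  ...   | no x∉  = y ∷ us , step e q , ¬Any⇒All¬ _ x∉ ∷ us! ,
                   λ { (here eq) → here eq ; (there i) → there (us⊆ i) }

  -- Since `p ≢ q`, the path has at least one step, so the cycle through `v` has at least three
  -- vertices.
  close-cycle : ∀ {p vs q v} → Path p vs q → Unique (p ∷ vs) → v ∉ p ∷ vs → p ≢ q →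
                Edge v p → Edge q v → Cycle G
  close-cycle stop         vs! v∉ p≢q e e′ = ⊥-elim (p≢q refl)
  close-cycle (step d π) vs! v∉ p≢q e e′ =
    _ , _ , ¬Any⇒All¬ _ v∉ ∷ vs! , s≤s (s≤s z≤n) , e ∷ path-linked (step d π) e′

  -- The first step of a simple path from `u` to `v` decides: if it does not already reach `v`, an
  -- edge between `u` and `v` would close a cycle.
  edge? : IsTree G → ∀ {u v} → Vertex u → Vertex v → Dec (Edge u v)
  edge? T {u} {v} Vu Vv with erase-loops (proj₂ (star⇒path (IsTree.connected T u v Vu Vv)))
  ... | _ , stop , _ = no edge-loopless
  ... | _ , step {y = y} e p , u∉ ∷ us! , _ with y ≟ v
  ...   | yes refl = yes e
  ...   | no y≢v   = no λ e′ → IsTree.acyclic T (close-cycle p us! (All¬⇒¬Any u∉) y≢v e (edge-sym e′))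

  -- Vertices form a predicate without an enumeration; a list grown by one attached vertex at a time
  -- supplies the finite object for the induction on edges.
  data Subtree : List U → Set where
    root  : ∀ {r} → Vertex r → Subtree [ r ]
    graft : ∀ {v p C} → Subtree C → v ∉ C → p ∈ C → Edge v p → Subtree (v ∷ C)

  subtree-unique : ∀ {C} → Subtree C → Unique C
  subtree-unique (root _)          = [] ∷ []
  subtree-unique (graft T v∉ _ _) = ¬Any⇒All¬ _ v∉ ∷ subtree-unique T

  subtree-vertex : ∀ {C x} → Subtree C → x ∈ C → Vertex x
  subtree-vertex (root Vr)       (here refl) = Vr
  subtree-vertex (graft _ _ _ e) (here refl) = edge-source e
  subtree-vertex (graft T _ _ _) (there x∈)  = subtree-vertex T x∈

  subtree-connected : ∀ {C x y} → Subtree C → x ∈ C → y ∈ C → ∃[ vs ] Path x vs y × All (_∈ C) vs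
  subtree-connected (root _) (here refl) (here refl) = [] , stop , []
  subtree-connected (graft _ _ _ _) (here refl) (here refl) = [] , stop , []
  subtree-connected (graft T _ p∈ e) (here refl) (there y∈) =
    let _ , π , vs∈ = subtree-connected T p∈ y∈ in _ , step e π , there p∈ ∷ All.map there vs∈
  subtree-connected (graft T _ p∈ e) (there x∈) (here refl) =
    let _ , π , vs∈ = subtree-connected T x∈ p∈
    in _ , path-snoc π (edge-sym e) , ∷ʳ⁺ (All.map there vs∈) (here refl)
  subtree-connected (graft T _ _ _) (there x∈) (there y∈) =
    let _ , π , vs∈ = subtree-connected T x∈ y∈ in _ , π , All.map there vs∈

  -- A path from `p` to `q` inside `C` avoids `v`, so two distinct neighbours would close it to a
  -- cycle through `v`.
  neighbour-unique : ∀ {C v p q} → ¬ Cycle G → Subtree C → v ∉ C → p ∈ C → q ∈ C →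
                     Edge v p → Edge v q → p ≡ q
  neighbour-unique {p = p} {q} acyclic T v∉ p∈ q∈ e e′ with p ≟ q
  ... | yes p≡q = p≡q
  ... | no p≢q  =
    let _ , π , vs∈       = subtree-connected T p∈ q∈
        _ , ϖ , us! , us⊆ = erase-loops π
        inside            = λ { (here refl) → p∈ ; (there x∈) → All.lookup vs∈ (us⊆ x∈) }
    in ⊥-elim (acyclic (close-cycle ϖ us! (v∉ ∘ inside) p≢q e (edge-sym e′)))

  -- Along the walk, each vertex not yet present is grafted onto its predecessor.
  subtree-reach : ∀ {C x y} → Subtree C → x ∈ C → Star Edge x y →
                  ∃[ D ] Subtree D × C ⊆ D × y ∈ D
  subtree-reach T x∈ ε = _ , T , id , x∈
  subtree-reach {C} T x∈ (_◅_ {j = z} e s) with z ∈? C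
  ... | yes z∈ = subtree-reach T z∈ s
  ... | no z∉  =
    let D , T′ , ⊆D , y∈ = subtree-reach (graft T z∉ x∈ (edge-sym e)) (here refl) s
    in D , T′ , ⊆D ∘ there , y∈

  spanning-subtree : IsTree G → ∀ vs → All Vertex vs → ∃[ C ] Subtree C × vs ⊆ C × ∃[ r ] r ∈ C
  spanning-subtree T [] [] =
    let r , Vr = IsTree.nonempty T in [ r ] , root Vr , (λ ()) , r , here refl
  spanning-subtree T (v ∷ vs) (Vv ∷ Vvs) =
    let _ , T₁ , vs⊆ , r , r∈ = spanning-subtree T vs Vvs
        D , T₂ , ⊆D , v∈      = subtree-reach T₁ r∈ (IsTree.connected T r v (subtree-vertex T₁ r∈) Vv)
    in D , T₂ , (λ { (here refl) → v∈ ; (there x∈) → ⊆D (vs⊆ x∈) }) , r , ⊆D r∈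

  InnerEdge : List U → Pred (U × U) 0ℓ
  InnerEdge C (x , y) = x ∈ C × y ∈ C × Edge x y

  -- Acyclicity makes each grafted vertex contribute exactly one edge, counted in both directions.
  subtree-edges : ∀ {C} → ¬ Cycle G → Subtree C →
                  ∃[ n ] HasCardinality (InnerEdge C) n × n + 2 ≡ 2 * length C
  subtree-edges acyclic (root _) =
    0 , ([] , [] , refl , λ _ → mk⇔ (λ ()) λ { (here refl , here refl , e) → ⊥-elim (edge-loopless e) }) , refl
  subtree-edges {v ∷ C} acyclic (graft {p = p} T v∉ p∈ e) with subtree-edges acyclic T
  ... | _ , (es , es! , refl , es⇔) , eq =
    _ , (es′ , es′! , refl , λ d → mk⇔ (sound d) (complete d)) ,
      trans (cong (2 +_) eq) (sym (*-suc 2 (length C)))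
    where
    es′ = (v , p) ∷ (p , v) ∷ es

    v≢p : v ≢ p
    v≢p refl = v∉ p∈

    es′! : Unique es′
    es′! = ((v≢p ∘ cong proj₁) ∷ ¬Any⇒All¬ _ (λ i → v∉ (proj₁ (to (es⇔ _) i))))
         ∷ ¬Any⇒All¬ _ (λ i → v∉ (proj₁ (proj₂ (to (es⇔ _) i))))
         ∷ es!

    sound : ∀ d → d ∈ es′ → InnerEdge (v ∷ C) d
    sound _ (here refl)         = here refl , there p∈ , e
    sound _ (there (here refl)) = there p∈ , here refl , edge-sym e
    sound _ (there (there i))   = let x∈ , y∈ , e′ = to (es⇔ _) i in there x∈ , there y∈ , e′

    complete : ∀ d → InnerEdge (v ∷ C) d → d ∈ es′
    complete _ (here refl , here refl , e′) = ⊥-elim (edge-loopless e′)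
    complete _ (here refl , there y∈ , e′)  =
      here (cong (v ,_) (neighbour-unique acyclic T v∉ y∈ p∈ e′ e))
    complete _ (there x∈ , here refl , e′)  =
      there (here (cong (_, v) (neighbour-unique acyclic T v∉ x∈ p∈ (edge-sym e′) e)))
    complete _ (there x∈ , there y∈ , e′)   = there (there (from (es⇔ _) (x∈ , y∈ , e′)))

  -- A subtree containing all vertices contains all edges. The double sum counts ordered pairs,
  -- hence each edge twice; the identity is edges = vertices - 1, doubled and freed of subtraction.
  tree-edges : ∀ us → Unique us → (∀ x → x ∈ us) → IsTree G →
               (V? : Decidable Vertex) (E? : ∀ x y → Dec (Edge x y)) →
               ∑ us (λ x → ∑ us (λ y → χ (E? x y))) + 2 ≡ 2 * ∑ us (χ ∘ V?)
  tree-edges us us! us∋ T V? E? =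
    let C , T′ , ⊆C , _ = spanning-subtree T (filter V? us)
                            (All.tabulate (λ i → proj₂ (∈-filter⁻ V? {xs = us} i)))
        V⇒∈C            = λ {x} (Vx : Vertex x) → ⊆C (∈-filter⁺ V? (us∋ x) Vx)
        n , (es , es! , len , es⇔) , eq = subtree-edges (IsTree.acyclic T) T′
        ∑E = ∑-χ (uncurry E?) (cartesianProduct us us) (cartesianProduct⁺ us! us!)
               (λ { {x , y} _ → ∈-cartesianProduct⁺ (us∋ x) (us∋ y) })
               (es , es! , len , λ d → mk⇔ (λ i → proj₂ (proj₂ (to (es⇔ d) i)))
                 (λ e → from (es⇔ d) (V⇒∈C (edge-source e) , V⇒∈C (edge-source (edge-sym e)) , e)))
        ∑V = ∑-χ V? us us! (λ {x} _ → us∋ x)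
               (C , subtree-unique T′ , refl , λ x → mk⇔ (subtree-vertex T′) V⇒∈C)
    in begin
      ∑ us (λ x → ∑ us (λ y → χ (E? x y))) + 2         ≡⟨ cong (_+ 2) (∑-cartesianProductWith _,_ us us _) ⟨
      ∑ (cartesianProduct us us) (χ ∘ uncurry E?) + 2  ≡⟨ cong (_+ 2) ∑E ⟩
      n + 2                                            ≡⟨ eq ⟩
      2 * length C                                     ≡⟨ cong (2 *_) ∑V ⟨
      2 * ∑ us (χ ∘ V?)                                ∎
    where open ≡-Reasoning

length-∷ʳ : ∀ {A : Set} (z : List A) b → length (z ∷ʳ b) ≡ suc (length z)
length-∷ʳ z b = trans (length-++ z) (+-comm (length z) 1)

-- Edge counts in bipartite trees.

module _ {A : Set} (_≟_ : DecidableEquality A)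
         (as : List A) (as! : Unique as) (as∋ : ∀ a → a ∈ as) where

  private
    us : List (A ⊎ A)
    us = map inj₁ as ++ map inj₂ as

    us! : Unique us
    us! = ++⁺ (map⁺ inj₁-injective as!) (map⁺ inj₂-injective as!) disjoint
      where
      disjoint : ∀ {u} → ¬ (u ∈ map inj₁ as × u ∈ map inj₂ as)
      disjoint (i , j) with ∈-map⁻ inj₁ i | ∈-map⁻ inj₂ j
      ... | _ , _ , refl | _ , _ , ()

    us∋ : ∀ u → u ∈ us
    us∋ (inj₁ a) = ∈-++⁺ˡ (∈-map⁺ inj₁ (as∋ a))
    us∋ (inj₂ b) = ∈-++⁺ʳ (map inj₁ as) (∈-map⁺ inj₂ (as∋ b))

    ∑-us : ∀ f → ∑ us f ≡ ∑ as (f ∘ inj₁) + ∑ as (f ∘ inj₂)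
    ∑-us f = trans (∑-++ (map inj₁ as) _ f) (cong₂ _+_ (∑-map inj₁ as f) (∑-map inj₂ as f))

  -- In the sum over ordered pairs the blocks inside one side vanish and the two mixed blocks agree
  -- by symmetry, so `tree-edges` gives twice this identity.
  bipartite-tree-edges : (G : Graph (A ⊎ A)) → let open Graph G in
    (∀ {a b} → ¬ Edge (inj₁ a) (inj₁ b)) → (∀ {a b} → ¬ Edge (inj₂ a) (inj₂ b)) → IsTree G →
    (V? : Decidable Vertex) (E? : ∀ x y → Dec (Edge x y)) →
    ∑ as (λ a → ∑ as (λ b → χ (E? (inj₁ a) (inj₂ b)))) + 1
      ≡ ∑ as (χ ∘ V? ∘ inj₁) + ∑ as (χ ∘ V? ∘ inj₂)
  bipartite-tree-edges G ¬₁₁ ¬₂₂ T V? E? = *-cancelˡ-≡ _ _ 2 (begin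
    2 * (e + 1)                          ≡⟨ *-distribˡ-+ 2 e 1 ⟩
    2 * e + 2                            ≡⟨ cong (λ t → e + t + 2) (+-identityʳ e) ⟩
    e + e + 2                            ≡⟨ cong (_+ 2) (cong₂ _+_ e₁ e₂) ⟨
    ∑ as (f ∘ inj₁) + ∑ as (f ∘ inj₂) + 2  ≡⟨ cong (_+ 2) (∑-us f) ⟨
    ∑ us f + 2                           ≡⟨ tree-edges (⊎-≡-dec _≟_ _≟_) G us us! us∋ T V? E? ⟩
    2 * ∑ us (χ ∘ V?)                    ≡⟨ cong (2 *_) (∑-us (χ ∘ V?)) ⟩
    2 * (∑ as (χ ∘ V? ∘ inj₁) + ∑ as (χ ∘ V? ∘ inj₂)) ∎)
    where
    open ≡-Reasoning
    open Graph G

    e = ∑ as (λ a → ∑ as (λ b → χ (E? (inj₁ a) (inj₂ b))))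

    f : A ⊎ A → ℕ
    f x = ∑ us (λ y → χ (E? x y))

    e₁ : ∑ as (f ∘ inj₁) ≡ e
    e₁ = ∑-cong as λ {a} _ → trans (∑-us _) (cong (_+ ∑ as (λ b → χ (E? (inj₁ a) (inj₂ b))))
           (trans (∑-cong as (λ _ → χ-false (E? _ _) ¬₁₁)) (∑-zero as)))

    e₂ : ∑ as (f ∘ inj₂) ≡ e
    e₂ = trans
      (∑-cong as λ {b} _ → trans (∑-us _) (trans (cong₂ _+_
        (∑-cong as (λ {a} _ → χ-⇔ (E? (inj₂ b) (inj₁ a)) (E? (inj₁ a) (inj₂ b)) edge-sym edge-sym))
        (trans (∑-cong as (λ _ → χ-false (E? _ _) ¬₂₂)) (∑-zero as))) (+-identityʳ _)))
      (sym (∑-swap as as _))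

  -- Membership and right-extension weights in a tree set of characteristic 2.

  module TreeSetCount (S : Language A) (T : TreeSet 2 S) where

    open TreeSet T
    open Factorial factorial
    open IsDisjointUnionOfTrees tree-empty

    S-[] : S []
    S-[] with IsTree.nonempty (tree Fin.zero)
    ... | inj₁ a , _ = factors ([] , [ a ] , refl) (letters a)
    ... | inj₂ a , _ = factors ([] , [ a ] , refl) (letters a)

    S-tail : ∀ {a z} → S (a ∷ z) → S z
    S-tail {a} {z} = factors ([ a ] , [] , cong (a ∷_) (sym (++-identityʳ z)))

    S-prefix : ∀ {u} v → S (u ++ v) → S u
    S-prefix v = factors ([] , v , refl)

    private
      component-of : ∀ u → ∃[ i ] Graph.Vertex (component i) u
      component-of (inj₁ a) = to (vertices (inj₁ a)) (letters a)
      component-of (inj₂ b) = to (vertices (inj₂ b)) (letters b)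

      V? : ∀ i → Decidable (Graph.Vertex (component i))
      V? i u with component-of u
      ... | j , Vu with i Fin.≟ j
      ...   | yes refl = yes Vu
      ...   | no i≢j   = no λ Vu′ → i≢j (disjoint Vu′ Vu)

      E? : ∀ i u v → Dec (Graph.Edge (component i) u v)
      E? i u v with V? i u | V? i v
      ... | yes Vu | yes Vv = edge? (⊎-≡-dec _≟_ _≟_) (component i) (tree i) Vu Vv
      ... | no ¬Vu | _      = no (¬Vu ∘ Graph.edge-source (component i))
      ... | yes _  | no ¬Vv = no (¬Vv ∘ Graph.edge-source (component i) ∘ Graph.edge-sym (component i))

    -- The extension graph of the empty word is only a forest, so the edge is sought in each of its
    -- component trees.
    S?-pair : ∀ a b → Dec (S (a ∷ b ∷ []))
    S?-pair a b = map′ (from (edges (inj₁ a) (inj₂ b))) (to (edges (inj₁ a) (inj₂ b)))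
                       (Fin.any? (λ i → E? i (inj₁ a) (inj₂ b)))

    private
      -- For nonempty `z`, once `a ∷ z` and `z ∷ʳ b` are known to lie in `S`, they are vertices of
      -- the tree of `z`, where adjacency is decidable. The bound drives the recursion, since
      -- `a ∷ z` is not a subterm of the word.
      S?-bounded : ∀ n v → length v ≤ n → Dec (S v)
      S?-bounded n       []      _ = yes S-[]
      S?-bounded (suc n) (a ∷ v) (s≤s v≤n) with initLast v
      ... | []           = yes (letters a)
      ... | [] ∷ʳ′ b     = S?-pair a b
      ... | z@(c ∷ y) ∷ʳ′ b
          with S?-bounded n (a ∷ z) (≤-trans (≤-reflexive (sym (length-∷ʳ z b))) v≤n)
             | S?-bounded n (z ∷ʳ b) v≤n
      ...   | no ¬az | _      = no (¬az ∘ factors ([] , [ b ] , refl))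
      ...   | yes _  | no ¬zb = no (¬zb ∘ S-tail)
      ...   | yes az | yes zb = edge? (⊎-≡-dec _≟_ _≟_) (extensionGraph factorial z)
                                  (tree-nonempty (S-tail az) (λ ())) {inj₁ a} {inj₂ b} az zb

    S? : Decidable S
    S? v = S?-bounded (length v) v ≤-refl

    r : Word A → ℕ
    r v = ∑ as (λ b → χ (S? (v ∷ʳ b)))

    -- Biextendability makes `r` positive on `S`; outside `S` it is 0 and truncated subtraction
    -- yields weight 0.
    ρ : Word A → ℕ
    ρ v = r v ∸ 1

    r-∉ : ∀ {v} → ¬ S v → r v ≡ 0
    r-∉ ¬Sv = trans (∑-cong as (λ {b} _ → χ-false (S? _) (¬Sv ∘ S-prefix [ b ]))) (∑-zero as)

    ρ-∉ : ∀ {v} → ¬ S v → ρ v ≡ 0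
    ρ-∉ ¬Sv = cong (_∸ 1) (r-∉ ¬Sv)

    χ+ρ≡r : ∀ v → χ (S? v) + ρ v ≡ r v
    χ+ρ≡r v with S? v
    ... | no ¬Sv = trans (ρ-∉ ¬Sv) (sym (r-∉ ¬Sv))
    ... | yes Sv with r v in eq
    ...   | suc _ = refl
    ...   | zero  = let _ , avb = extend Sv
                        1≡0 = trans (sym (χ-true (S? _) (S-tail avb))) (∑≡0⇒≡0 eq (as∋ _))
                    in ⊥-elim (1+n≢0 1≡0)

    private
      ∑ρ+∑χ : ∀ z → ∑ as (λ a → ρ (a ∷ z)) + ∑ as (λ a → χ (S? (a ∷ z))) ≡ ∑ as (λ a → r (a ∷ z))
      ∑ρ+∑χ z = trans (sym (∑-+ as _ _)) (∑-cong as λ {a} _ → trans (+-comm (ρ (a ∷ z)) _) (χ+ρ≡r (a ∷ z)))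

    -- The edges of the extension graph of `z`, sorted by their left end `a`, are counted by
    -- `r (a ∷ z)`.
    r-extension : ∀ {z} → S z → z ≢ [] →
      ∑ as (λ a → r (a ∷ z)) + 1 ≡ ∑ as (λ a → χ (S? (a ∷ z))) + r z
    r-extension {z} Sz z≢[] = bipartite-tree-edges (extensionGraph factorial z) id id
        (tree-nonempty Sz z≢[]) Vz? Ez?
      where
      Vz? : Decidable (Graph.Vertex (extensionGraph factorial z))
      Vz? (inj₁ a) = S? (a ∷ z)
      Vz? (inj₂ b) = S? (z ∷ʳ b)

      Ez? : ∀ x y → Dec (Graph.Edge (extensionGraph factorial z) x y)
      Ez? (inj₁ a) (inj₂ b) = S? (a ∷ (z ∷ʳ b))
      Ez? (inj₂ b) (inj₁ a) = S? (a ∷ (z ∷ʳ b))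
      Ez? (inj₁ _) (inj₁ _) = no id
      Ez? (inj₂ _) (inj₂ _) = no id

    -- As `r` is 1 + `ρ` on `S`, each left letter of `z` adds 1 to the edge count; cancelling these
    -- against the left vertices of the tree leaves the weights.
    ρ-additive : ∀ z → z ≢ [] → ∑ as (λ a → ρ (a ∷ z)) ≡ ρ z
    ρ-additive z z≢[] with S? z
    ... | no ¬Sz = trans (trans (∑-cong as (λ _ → ρ-∉ (¬Sz ∘ S-tail))) (∑-zero as)) (sym (ρ-∉ ¬Sz))
    ... | yes Sz = trans (sym (m+n∸n≡m ∑ρ 1)) (cong (_∸ 1) (+-cancelʳ-≡ l (∑ρ + 1) (r z) (begin
        ∑ρ + 1 + l                    ≡⟨ +-assoc ∑ρ 1 l ⟩
        ∑ρ + (1 + l)                  ≡⟨ cong (∑ρ +_) (+-comm 1 l) ⟩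
        ∑ρ + (l + 1)                  ≡⟨ +-assoc ∑ρ l 1 ⟨
        ∑ρ + l + 1                    ≡⟨ cong (_+ 1) (∑ρ+∑χ z) ⟩
        ∑ as (λ a → r (a ∷ z)) + 1    ≡⟨ r-extension Sz z≢[] ⟩
        l + r z                       ≡⟨ +-comm l (r z) ⟩
        r z + l                       ∎)))
      where
      open ≡-Reasoning
      ∑ρ = ∑ as (λ a → ρ (a ∷ z))
      l  = ∑ as (λ a → χ (S? (a ∷ z)))

    -- Each of the two component trees has one more vertex than edges, and together their vertices
    -- are two copies of the alphabet.
    r-letters : ∑ as (λ a → r [ a ]) + 2 ≡ length as + length as
    r-letters = begin
      ∑ as (λ a → r [ a ]) + 2   ≡⟨ cong (_+ 2) (trans (∑-cong as (λ _ →
                                      trans (∑-cong as (λ _ → split-edge)) (∑-+ as _ _))) (∑-+ as _ _)) ⟩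
      e₀ + e₁ + (1 + 1)          ≡⟨ interchange e₀ e₁ 1 1 ⟩
      e₀ + 1 + (e₁ + 1)          ≡⟨ cong₂ _+_ (component-edges Fin.zero) (component-edges (Fin.suc Fin.zero)) ⟩
      (l₀ + r₀) + (l₁ + r₁)      ≡⟨ interchange l₀ r₀ l₁ r₁ ⟩
      (l₀ + l₁) + (r₀ + r₁)      ≡⟨ cong₂ _+_ (∑-vertices inj₁) (∑-vertices inj₂) ⟩
      length as + length as      ∎
      where
      open ≡-Reasoning

      0F 1F : Fin 2
      0F = Fin.zero
      1F = Fin.suc Fin.zero

      e : Fin 2 → ℕ
      e i = ∑ as (λ a → ∑ as (λ b → χ (E? i (inj₁ a) (inj₂ b))))

      e₀ = e 0F
      e₁ = e 1F
      l₀ = ∑ as (χ ∘ V? 0F ∘ inj₁)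
      l₁ = ∑ as (χ ∘ V? 1F ∘ inj₁)
      r₀ = ∑ as (χ ∘ V? 0F ∘ inj₂)
      r₁ = ∑ as (χ ∘ V? 1F ∘ inj₂)

      bipartite : ∀ {i u v} → Graph.Edge (component i) u v → Graph.Edge (extensionGraph factorial []) u v
      bipartite e = from (edges _ _) (_ , e)

      component-edges : ∀ i → e i + 1 ≡ ∑ as (χ ∘ V? i ∘ inj₁) + ∑ as (χ ∘ V? i ∘ inj₂)
      component-edges i = bipartite-tree-edges (component i) bipartite bipartite (tree i) (V? i) (E? i)

      edge-disjoint : ∀ {u v} → ¬ (Graph.Edge (component 0F) u v × Graph.Edge (component 1F) u v)
      edge-disjoint (e , e′) with disjoint (Graph.edge-source (component 0F) e) (Graph.edge-source (component 1F) e′)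
      ... | ()

      split-edge : ∀ {a b} → χ (S? (a ∷ b ∷ [])) ≡ χ (E? 0F (inj₁ a) (inj₂ b)) + χ (E? 1F (inj₁ a) (inj₂ b))
      split-edge {a} {b} = χ-⊎ (S? _) (E? 0F (inj₁ a) (inj₂ b)) (E? 1F (inj₁ a) (inj₂ b))
          (mk⇔ (index ∘ to (edges (inj₁ a) (inj₂ b))) [ bipartite , bipartite ]′) edge-disjoint
        where
        index : ∀ {u v} → ∃[ i ] Graph.Edge (component i) u v →
                Graph.Edge (component 0F) u v ⊎ Graph.Edge (component 1F) u v
        index (Fin.zero         , e) = inj₁ e
        index (Fin.suc Fin.zero , e) = inj₂ e

      split-vertex : ∀ u → χ (V? 0F u) + χ (V? 1F u) ≡ 1
      split-vertex u with component-of u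
      ... | Fin.zero         , _ = refl
      ... | Fin.suc Fin.zero , _ = refl

      ∑-vertices : ∀ (inj : A → A ⊎ A) → ∑ as (χ ∘ V? 0F ∘ inj) + ∑ as (χ ∘ V? 1F ∘ inj) ≡ length as
      ∑-vertices inj = trans (sym (∑-+ as _ _)) (trans (∑-cong as (λ {a} _ → split-vertex (inj a))) (∑-one as))

    -- The same cancellation as for `ρ-additive`, now with two trees in place of one.
    ρ-letters : ∑ as (λ a → ρ [ a ]) + 2 ≡ length as
    ρ-letters = +-cancelʳ-≡ k (∑ρ + 2) k (begin
        ∑ρ + 2 + k      ≡⟨ +-assoc ∑ρ 2 k ⟩
        ∑ρ + (2 + k)    ≡⟨ cong (∑ρ +_) (+-comm 2 k) ⟩
        ∑ρ + (k + 2)    ≡⟨ +-assoc ∑ρ k 2 ⟨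
        ∑ρ + k + 2      ≡⟨ cong (λ t → ∑ρ + t + 2) ∑χ ⟨
        ∑ρ + ∑ as (λ a → χ (S? [ a ])) + 2  ≡⟨ cong (_+ 2) (∑ρ+∑χ []) ⟩
        ∑ as (λ a → r [ a ]) + 2  ≡⟨ r-letters ⟩
        k + k           ∎)
      where
      open ≡-Reasoning
      k  = length as
      ∑ρ = ∑ as (λ a → ρ [ a ])
      ∑χ : ∑ as (λ a → χ (S? [ a ])) ≡ k
      ∑χ = trans (∑-cong as (λ {a} _ → χ-true (S? [ a ]) (letters a))) (∑-one as)

-- Uniqueness, uniform bounds and words of a given length.

∑-χ≤1⇒unique : ∀ {B : Set} {P : Pred B 0ℓ} (P? : Decidable P) {xs x y} →
               ∑ xs (χ ∘ P?) ≤ 1 → x ∈ xs → y ∈ xs → P x → P y → x ≡ y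
∑-χ≤1⇒unique P? ∑≤1 (here refl) (here refl) Px Py = refl
∑-χ≤1⇒unique P? {_ ∷ xs} {x} {y} ∑≤1 (here refl) (there y∈) Px Py rewrite χ-true (P? x) Px =
  ⊥-elim (1+n≢0 (trans (sym (χ-true (P? y) Py)) (∑≡0⇒≡0 (n≤0⇒n≡0 (≤-pred ∑≤1)) y∈)))
∑-χ≤1⇒unique P? {_ ∷ xs} {x} {y} ∑≤1 (there x∈) (here refl) Px Py rewrite χ-true (P? y) Py =
  ⊥-elim (1+n≢0 (trans (sym (χ-true (P? x) Px)) (∑≡0⇒≡0 (n≤0⇒n≡0 (≤-pred ∑≤1)) x∈)))
∑-χ≤1⇒unique P? {z ∷ xs} ∑≤1 (there x∈) (there y∈) Px Py =
  ∑-χ≤1⇒unique P? (≤-trans (m≤n+m (∑ xs (χ ∘ P?)) (χ (P? z))) ∑≤1) x∈ y∈ Px Py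

-- Monotonicity lets the maximum of the individual bounds serve for the whole list.
common-bound : ∀ {B : Set} {Q : B → ℕ → Set} → (∀ {x d e} → d ≤ e → Q x d → Q x e) →
               (∀ x → ∃[ d ] Q x d) → ∀ xs → ∃[ d ] (∀ {x} → x ∈ xs → Q x d)
common-bound mono bound []       = 0 , λ ()
common-bound mono bound (x ∷ xs) =
  let d , Qx = bound x
      e , Qxs = common-bound mono bound xs
  in d ⊔ e , λ { (here refl) → mono (m≤m⊔n d e) Qx ; (there i) → mono (m≤n⊔m d e) (Qxs i) }

∷ʳ≢[] : ∀ {A : Set} (q : List A) {b} → q ∷ʳ b ≢ []
∷ʳ≢[] []      ()
∷ʳ≢[] (_ ∷ _) ()

++-∷ʳ : ∀ {A : Set} (p x q : List A) b → p ++ x ++ (q ∷ʳ b) ≡ (p ++ x ++ q) ∷ʳ b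
++-∷ʳ p x q b = sym (trans (++-assoc p (x ++ q) [ b ]) (cong (p ++_) (++-assoc x q [ b ])))

factor-length : ∀ {A : Set} {x v : List A} → Factor x v → length x ≤ length v
factor-length {x = x} (p , q , refl) = begin
  length x                    ≤⟨ m≤m+n (length x) (length q) ⟩
  length x + length q         ≡⟨ length-++ x ⟨
  length (x ++ q)             ≤⟨ m≤n+m _ (length p) ⟩
  length p + length (x ++ q)  ≡⟨ length-++ p ⟨
  length (p ++ x ++ q)        ∎
  where open ≤-Reasoning

take-length-++ : ∀ {A : Set} (x : List A) {q} → take (length x) (x ++ q) ≡ x
take-length-++ []      = refl
take-length-++ (a ∷ x) = cong (a ∷_) (take-length-++ x)

module _ {A : Set} (as : List A) where

  words : ℕ → List (Word A)
  words zero    = [ [] ]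
  words (suc n) = cartesianProductWith _∷_ as (words n)

  ∈-words⁺ : (∀ a → a ∈ as) → ∀ v → v ∈ words (length v)
  ∈-words⁺ as∋ []      = here refl
  ∈-words⁺ as∋ (a ∷ v) = ∈-cartesianProductWith⁺ _∷_ (as∋ a) (∈-words⁺ as∋ v)

  ∈-words⁻ : ∀ n {v} → v ∈ words n → length v ≡ n
  ∈-words⁻ zero    (here refl) = refl
  ∈-words⁻ (suc n) v∈ with ∈-cartesianProductWith⁻ _∷_ as (words n) v∈
  ... | _ , _ , _ , z∈ , refl = cong suc (∈-words⁻ n z∈)

  words! : Unique as → ∀ n → Unique (words n)
  words! as! zero    = [] ∷ []
  words! as! (suc n) = cartesianProductWith⁺ _∷_ ∷-injective as! (words! as! n)

  ∑-words-∷ : ∀ n f → ∑ (words (suc n)) f ≡ ∑ (words n) (λ z → ∑ as (λ a → f (a ∷ z)))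
  ∑-words-∷ n f = trans (∑-cartesianProductWith _∷_ as (words n) f) (∑-swap as (words n) _)

  -- The enumeration grows words on the left, whereas counting right extensions requires growth on
  -- the right.
  ∑-words-∷ʳ : ∀ n f → ∑ (words (suc n)) f ≡ ∑ (words n) (λ z → ∑ as (λ b → f (z ∷ʳ b)))
  ∑-words-∷ʳ zero    f = ∑-words-∷ 0 f
  ∑-words-∷ʳ (suc n) f = begin
    ∑ (words (2 + n)) f
      ≡⟨ ∑-cartesianProductWith _∷_ as (words (suc n)) f ⟩
    ∑ as (λ a → ∑ (words (suc n)) (λ z → f (a ∷ z)))
      ≡⟨ ∑-cong as (λ {a} _ → ∑-words-∷ʳ n (λ z → f (a ∷ z))) ⟩
    ∑ as (λ a → ∑ (words n) (λ z → ∑ as (λ b → f (a ∷ (z ∷ʳ b)))))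
      ≡⟨ ∑-cartesianProductWith _∷_ as (words n) (λ z → ∑ as (λ b → f (z ∷ʳ b))) ⟨
    ∑ (words (suc n)) (λ z → ∑ as (λ b → f (z ∷ʳ b))) ∎
    where open ≡-Reasoning

-- Complete return words to a finite set of words of common positive length.

module ReturnWords {A : Set} (_≟_ : DecidableEquality A)
  (as : List A) (as! : Unique as) (as∋ : ∀ a → a ∈ as)
  (S : Language A) (T : TreeSet 2 S) (Srec : Recurrent S)
  (X : Language A) (m c : ℕ) (X-card : HasCardinality X c) (X⊆S : ∀ {x} → X x → S x)
  (X-length : ∀ {x} → X x → length x ≡ suc m) (x₀ : Word A) (x₀∈X : X x₀)
  where

  open TreeSetCount _≟_ as as! as∋ S T
  open Recurrent Srec using (recur)
  open import Data.List.Membership.DecPropositional (≡-dec _≟_) using (_∈?_)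

  private
    W : ℕ → List (Word A)
    W = words as

  X? : Decidable X
  X? x = map′ (to (X-list x)) (from (X-list x)) (x ∈? proj₁ X-card)
    where X-list = proj₂ (proj₂ (proj₂ X-card))

  Occ : Word A → Set
  Occ v = ∃[ x ] X x × Factor x v

  occ-length : ∀ {v} → Occ v → m < length v
  occ-length (x , Xx , x≤v) = subst (_≤ _) (X-length Xx) (factor-length x≤v)

  occ-∷ : ∀ {a v} → Occ v → Occ (a ∷ v)
  occ-∷ {a} (x , Xx , p , q , refl) = x , Xx , a ∷ p , q , refl

  occ-++ˡ : ∀ {v} u → Occ v → Occ (v ++ u)
  occ-++ˡ u (x , Xx , p , q , refl) =
    x , Xx , p , q ++ u , trans (++-assoc p (x ++ q) u) (cong (p ++_) (++-assoc x q u))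

  occ-++ʳ : ∀ u {v} → Occ v → Occ (u ++ v)
  occ-++ʳ []      o = o
  occ-++ʳ (a ∷ u) o = occ-∷ (occ-++ʳ u o)

  X⇒occ : ∀ {x} → X x → Occ x
  X⇒occ {x} Xx = x , Xx , [] , [] , sym (++-identityʳ x)

  -- As all words of `X` have length `suc m`, only the prefix of this length can be an occurrence at
  -- the start.
  Occ? : Decidable Occ
  Occ? []      = no λ o → n≮0 (occ-length o)
  Occ? (a ∷ v) = map′ join split (X? (take (suc m) (a ∷ v)) ⊎-dec Occ? v)
    where
    join : X (take (suc m) (a ∷ v)) ⊎ Occ v → Occ (a ∷ v)
    join (inj₁ Xx) = subst Occ (take++drop≡id (suc m) (a ∷ v)) (occ-++ˡ _ (X⇒occ Xx))
    join (inj₂ o)  = occ-∷ o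

    split : Occ (a ∷ v) → X (take (suc m) (a ∷ v)) ⊎ Occ v
    split (x , Xx , [] , q , eq)    = inj₁ (subst X (sym (begin
      take (suc m) (a ∷ v)      ≡⟨ cong (take (suc m)) eq ⟩
      take (suc m) (x ++ q)     ≡⟨ cong (λ n → take n (x ++ q)) (X-length Xx) ⟨
      take (length x) (x ++ q)  ≡⟨ take-length-++ x ⟩
      x                         ∎)) Xx)
      where open ≡-Reasoning
    split (x , Xx , _ ∷ p , q , eq) = inj₂ (x , Xx , p , q , ∷-injectiveʳ eq)

  -- A word of `X` has `m + 1` letters and the whole word at least `m + 2`, so an occurrence misses
  -- the first or the last letter.
  occ-ends : ∀ {a z b} → m ≤ length z → Occ (a ∷ (z ∷ʳ b)) → Occ (a ∷ z) ⊎ Occ (z ∷ʳ b)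
  occ-ends {a} {z} {b} m≤z (x , Xx , p , q , eq) with initLast q
  occ-ends {a} {z} {b} m≤z (x , Xx , p , _ , eq) | q ∷ʳ′ d =
    inj₁ (x , Xx , p , q , ∷ʳ-injectiveˡ (a ∷ z) _ (trans eq (++-∷ʳ p x q d)))
  occ-ends {a} {z} {b} m≤z (x , Xx , _ ∷ p , _ , eq) | [] = inj₂ (x , Xx , p , [] , ∷-injectiveʳ eq)
  occ-ends {a} {z} {b} m≤z (x , Xx , [] , _ , eq) | [] = ⊥-elim (<-irrefl (begin
      suc m                     ≡⟨ X-length Xx ⟨
      length x                  ≡⟨ cong length (++-identityʳ x) ⟨
      length (x ++ [])          ≡⟨ cong length eq ⟨
      suc (length (z ∷ʳ b))     ≡⟨ cong suc (length-∷ʳ z b) ⟩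
      suc (suc (length z))      ∎) (s≤s (s≤s m≤z)))
    where open ≡-Reasoning

  -- Numerical forms of meeting and of avoiding `X`, so that conditions on words become factors in
  -- sums.
  β α : Word A → ℕ
  β v = χ (Occ? v)
  α v = 1 ∸ β v

  CR : Word A → Set
  CR = CompleteReturnWord S X

  open CompleteReturnWord

  -- The internal factors of the word are the factors of `z`. Once `z` avoids `X`, an occurrence in
  -- `a ∷ z` is a prefix and one in `z ∷ʳ b` a suffix.
  CR-letters : ∀ {a z b} → CR (a ∷ (z ∷ʳ b)) ⇔ (S (a ∷ (z ∷ʳ b)) × ¬ Occ z × Occ (a ∷ z) × Occ (z ∷ʳ b))
  CR-letters {a} {z} {b} = mk⇔ (λ cr → member cr , avoid cr , pre cr , suf cr) build
    where
    avoid : CR (a ∷ (z ∷ʳ b)) → ¬ Occ z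
    avoid cr (x , Xx , p , q , eq) = no-internal cr Xx
      (a ∷ p , q ∷ʳ b , (λ ()) , ∷ʳ≢[] q ,
       cong (a ∷_) (trans (cong (_∷ʳ b) eq) (sym (++-∷ʳ p x q b))))

    pre : CR (a ∷ (z ∷ʳ b)) → Occ (a ∷ z)
    pre cr with prefix cr
    ... | x , Xx , u , u≢[] , eq with initLast u
    ...   | []      = ⊥-elim (u≢[] refl)
    ...   | v ∷ʳ′ d = x , Xx , [] , v , ∷ʳ-injectiveˡ (a ∷ z) _ (trans eq (++-∷ʳ [] x v d))

    suf : CR (a ∷ (z ∷ʳ b)) → Occ (z ∷ʳ b)
    suf cr with suffix cr
    ... | x , Xx , []    , u≢[] , eq = ⊥-elim (u≢[] refl)
    ... | x , Xx , _ ∷ p , _    , eq =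
      x , Xx , p , [] , trans (∷-injectiveʳ eq) (cong (p ++_) (sym (++-identityʳ x)))

    build : S (a ∷ (z ∷ʳ b)) × ¬ Occ z × Occ (a ∷ z) × Occ (z ∷ʳ b) → CR (a ∷ (z ∷ʳ b))
    build (Sy , ¬oz , oaz , ozb) = record
      { member = Sy ; prefix = prefix′ oaz ; suffix = suffix′ ozb ; no-internal = no-internal′ }
      where
      prefix′ : Occ (a ∷ z) → ∃[ x ] X x × ProperPrefix x (a ∷ (z ∷ʳ b))
      prefix′ (x , Xx , []    , q , eq) =
        x , Xx , q ∷ʳ b , ∷ʳ≢[] q , trans (cong (_∷ʳ b) eq) (sym (++-∷ʳ [] x q b))
      prefix′ (x , Xx , _ ∷ p , q , eq) = ⊥-elim (¬oz (x , Xx , p , q , ∷-injectiveʳ eq))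

      suffix′ : Occ (z ∷ʳ b) → ∃[ x ] X x × ProperSuffix x (a ∷ (z ∷ʳ b))
      suffix′ (x , Xx , p , q , eq) with initLast q
      ... | []      = x , Xx , a ∷ p , (λ ()) , cong (a ∷_) (trans eq (cong (p ++_) (++-identityʳ x)))
      ... | v ∷ʳ′ d = ⊥-elim (¬oz (x , Xx , p , v , ∷ʳ-injectiveˡ z _ (trans eq (++-∷ʳ p x v d))))

      no-internal′ : ∀ {x} → X x → ¬ InternalFactor x (a ∷ (z ∷ʳ b))
      no-internal′ {x} Xx ([]    , q , p≢[] , q≢[] , eq) = p≢[] refl
      no-internal′ {x} Xx (_ ∷ p , q , p≢[] , q≢[] , eq) with initLast q
      ... | []      = q≢[] refl
      ... | v ∷ʳ′ d = ¬oz (x , Xx , p , v , ∷ʳ-injectiveˡ z _ (trans (∷-injectiveʳ eq) (++-∷ʳ p x v d)))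

  CR-length : ∀ {y} → CR y → 2 + m ≤ length y
  CR-length cr with prefix cr
  ... | x , Xx , []    , u≢[] , _    = ⊥-elim (u≢[] refl)
  ... | x , Xx , d ∷ u , _    , refl = begin
    2 + m                           ≡⟨ cong suc (X-length Xx) ⟨
    suc (length x)                  ≤⟨ s≤s (m≤m+n (length x) (length u)) ⟩
    suc (length x + length u)       ≡⟨ +-suc (length x) (length u) ⟨
    length x + suc (length u)       ≡⟨ length-++ x ⟨
    length (x ++ d ∷ u)             ∎
    where open ≤-Reasoning

  CR? : Decidable CR
  CR? []      = no λ cr → n≮0 (CR-length cr)
  CR? (a ∷ v) with initLast v
  ... | []      = no λ cr → n≮0 (≤-pred (CR-length cr))
  ... | z ∷ʳ′ b = map′ (from CR-letters) (to CR-letters)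
                    (S? (a ∷ (z ∷ʳ b)) ×-dec ¬? (Occ? z) ×-dec Occ? (a ∷ z) ×-dec Occ? (z ∷ʳ b))

  -- U a z says that the word a z of S meets X exactly once, at its beginning.
  U : A → Word A → Set
  U a z = S (a ∷ z) × ¬ Occ z × Occ (a ∷ z)

  U? : ∀ a z → Dec (U a z)
  U? a z = S? (a ∷ z) ×-dec ¬? (Occ? z) ×-dec Occ? (a ∷ z)

  -- Since `z ∷ʳ b` avoids `X`, the occurrence must lie in `a ∷ z`. This closure under shortening
  -- gives the forest its parent relation.
  U-init : ∀ {a z b} → m ≤ length z → U a (z ∷ʳ b) → U a z
  U-init {b = b} m≤z (Sy , ¬ozb , oazb) =
    S-prefix [ b ] Sy , ¬ozb ∘ occ-++ˡ [ b ] , [ id , ⊥-elim ∘ ¬ozb ]′ (occ-ends m≤z oazb)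

  U-prefix : ∀ {a z} v → m ≤ length z → U a (z ++ v) → U a z
  U-prefix {a} {z} []      m≤z u = subst (U a) (++-identityʳ z) u
  U-prefix {a} {z} (b ∷ v) m≤z u =
    U-init m≤z (U-prefix v (≤-trans m≤z (≤-trans (n≤1+n _) (≤-reflexive (sym (length-∷ʳ z b)))))
                           (subst (U a) (sym (∷ʳ-++ z b v)) u))

  -- Level n gathers the words a z with |z| = n: μ counts those with U a z, σ is their total ρ-weight,
  -- and τ is the ρ-weight of all those whose tail z avoids X.
  τ μ σ : ℕ → ℕ
  τ n = ∑ (W n) (λ z → α z * ∑ as (λ a → ρ (a ∷ z)))
  μ n = ∑ (W n) (λ z → ∑ as (λ a → α z * (β (a ∷ z) * χ (S? (a ∷ z)))))
  σ n = ∑ (W n) (λ z → ∑ as (λ a → α z * (β (a ∷ z) * ρ (a ∷ z))))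

  -- Conservation laws from one level to the next.

  private
    W-length : ∀ n {v} → v ∈ W n → length v ≡ n
    W-length = ∈-words⁻ as

    ∈-W : ∀ {n} v → length v ≡ n → v ∈ W n
    ∈-W v refl = ∈-words⁺ as as∋ v

  ∑∑-cong : ∀ n {f g : Word A → A → ℕ} → (∀ {z} a → length z ≡ n → f z a ≡ g z a) →
            ∑ (W n) (λ z → ∑ as (f z)) ≡ ∑ (W n) (λ z → ∑ as (g z))
  ∑∑-cong n eq = ∑-cong (W n) λ z∈ → ∑-cong as λ {a} _ → eq a (W-length n z∈)

  ∑∑-+ : ∀ n (f g : Word A → A → ℕ) →
         ∑ (W n) (λ z → ∑ as (λ a → f z a + g z a)) ≡ ∑ (W n) (λ z → ∑ as (f z)) + ∑ (W n) (λ z → ∑ as (g z))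
  ∑∑-+ n f g = trans (∑-cong (W n) λ _ → ∑-+ as _ _) (∑-+ (W n) _ _)

  ∑∑-zero : ∀ n {f : Word A → A → ℕ} → (∀ {z} a → length z ≡ n → f z a ≡ 0) →
            ∑ (W n) (λ z → ∑ as (f z)) ≡ 0
  ∑∑-zero n eq = trans (∑∑-cong n eq) (trans (∑-cong (W n) λ _ → ∑-zero as) (∑-zero (W n)))

  -- When `z` avoids `X`, the word `a ∷ z` either meets `X` and contributes to `σ`, or still avoids
  -- it; in the second case additivity passes its weight to its left extensions.
  τ-step : ∀ n → τ n ≡ σ n + τ (suc n)
  τ-step n = begin
    τ n
      ≡⟨ ∑-cong (W n) (λ {z} _ → sym (∑-* as (α z) _)) ⟩
    ∑ (W n) (λ z → ∑ as (λ a → α z * ρ (a ∷ z)))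
      ≡⟨ ∑∑-cong n (λ {z} a _ → split (Occ? z) (Occ? (a ∷ z)) (occ-∷ {a} {z}) (ρ (a ∷ z))) ⟩
    ∑ (W n) (λ z → ∑ as (λ a → α z * (β (a ∷ z) * ρ (a ∷ z)) + α (a ∷ z) * ρ (a ∷ z)))
      ≡⟨ ∑∑-+ n _ _ ⟩
    σ n + ∑ (W n) (λ z → ∑ as (λ a → α (a ∷ z) * ρ (a ∷ z)))
      ≡⟨ cong (σ n +_) (∑-words-∷ as n (λ y → α y * ρ y)) ⟨
    σ n + ∑ (W (suc n)) (λ y → α y * ρ y)
      ≡⟨ cong (σ n +_) (∑-cong (W (suc n)) (λ {y} y∈ → cong (α y *_) (ρ-additive y (nonempty y∈)))) ⟨
    σ n + τ (suc n) ∎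
    where
    open ≡-Reasoning

    nonempty : ∀ {y} → y ∈ W (suc n) → y ≢ []
    nonempty y∈ refl = 0≢1+n (W-length (suc n) y∈)

    split : ∀ {P Q : Set} (P? : Dec P) (Q? : Dec Q) → (P → Q) → ∀ x →
            (1 ∸ χ P?) * x ≡ (1 ∸ χ P?) * (χ Q? * x) + (1 ∸ χ Q?) * x
    split (yes p) (yes _) _   x = refl
    split (yes p) (no ¬q) p⇒q x = ⊥-elim (¬q (p⇒q p))
    split (no _)  (yes _) _   x = sym (trans (+-identityʳ _) (+-identityʳ _))
    split (no _)  (no _)  _   x = refl

  -- A right extension in `S` of a U-word is either a leaf or a U-word of the next level, and a
  -- U-word of weight `ρ` has 1 + `ρ` of them; `μ n + σ n` thus counts the children of level `n`.
  returns-step : ∀ n → m ≤ n → ∑ (W (2 + n)) (χ ∘ CR?) + μ (suc n) ≡ μ n + σ n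
  returns-step n m≤n = begin
    ∑ (W (2 + n)) (χ ∘ CR?) + μ (suc n)
      ≡⟨ cong₂ _+_ (trans (∑-words-∷ as (suc n) _) (reorder (λ y a → χ (CR? (a ∷ y)))))
                   (reorder (λ y a → α y * (β (a ∷ y) * χ (S? (a ∷ y))))) ⟩
    ∑ (W n) (λ z → ∑ as (λ a → ∑ as (λ b → χ (CR? (a ∷ (z ∷ʳ b))))))
      + ∑ (W n) (λ z → ∑ as (λ a → ∑ as (λ b → α (z ∷ʳ b) * (β (a ∷ (z ∷ʳ b)) * χ (S? (a ∷ (z ∷ʳ b)))))))
      ≡⟨ ∑∑-+ n _ _ ⟨
    ∑ (W n) (λ z → ∑ as (λ a → ∑ as (λ b → χ (CR? (a ∷ (z ∷ʳ b))))
                             + ∑ as (λ b → α (z ∷ʳ b) * (β (a ∷ (z ∷ʳ b)) * χ (S? (a ∷ (z ∷ʳ b)))))))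
      ≡⟨ ∑∑-cong n (λ {z} a z≡n → letterwise a z (subst (m ≤_) (sym z≡n) m≤n)) ⟩
    ∑ (W n) (λ z → ∑ as (λ a → α z * (β (a ∷ z) * χ (S? (a ∷ z))) + α z * (β (a ∷ z) * ρ (a ∷ z))))
      ≡⟨ ∑∑-+ n _ _ ⟩
    μ n + σ n ∎
    where
    open ≡-Reasoning

    reorder : (f : Word A → A → ℕ) →
              ∑ (W (suc n)) (λ y → ∑ as (f y)) ≡ ∑ (W n) (λ z → ∑ as (λ a → ∑ as (λ b → f (z ∷ʳ b) a)))
    reorder f = trans (∑-words-∷ʳ as n (λ y → ∑ as (f y)))
                      (∑-cong (W n) λ {z} _ → ∑-swap as as (λ b a → f (z ∷ʳ b) a))

    -- The cases run over the truth values of the four occurrence conditions; `occ-ends` and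
    -- `occ-++ˡ` rule out the inconsistent ones.
    extension : ∀ {a z b} → m ≤ length z →
      (cr : Dec (CR (a ∷ (z ∷ʳ b)))) (s : Dec (S (a ∷ (z ∷ʳ b)))) (oz : Dec (Occ z))
      (oaz : Dec (Occ (a ∷ z))) (ozb : Dec (Occ (z ∷ʳ b))) (oazb : Dec (Occ (a ∷ (z ∷ʳ b)))) →
      χ cr + (1 ∸ χ ozb) * (χ oazb * χ s) ≡ (1 ∸ χ oz) * (χ oaz * χ s)
    extension {b = b} _ cr s (yes oz) oaz (no ¬ozb) oazb = ⊥-elim (¬ozb (occ-++ˡ [ b ] oz))
    extension _ cr s (yes oz) oaz (yes _) oazb =
      cong (_+ 0) (χ-false cr (λ y → proj₁ (proj₂ (to CR-letters y)) oz))
    extension _ cr s (no _) (no ¬oaz) (yes _) oazb =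
      cong (_+ 0) (χ-false cr (λ y → ¬oaz (proj₁ (proj₂ (proj₂ (to CR-letters y))))))
    extension m≤z cr s (no _) (no ¬oaz) (no ¬ozb) (yes o) = ⊥-elim ([ ¬oaz , ¬ozb ]′ (occ-ends m≤z o))
    extension _ cr s (no _) (no ¬oaz) (no _) (no _) =
      cong (_+ 0) (χ-false cr (λ y → ¬oaz (proj₁ (proj₂ (proj₂ (to CR-letters y))))))
    extension _ cr s (no ¬oz) (yes oaz) (yes ozb) oazb = begin
      χ cr + 0         ≡⟨ +-identityʳ _ ⟩
      χ cr             ≡⟨ χ-⇔ cr s member (λ Sy → from CR-letters (Sy , ¬oz , oaz , ozb)) ⟩
      χ s              ≡⟨ +-identityʳ _ ⟨
      χ s + 0          ≡⟨ +-identityʳ _ ⟨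
      χ s + 0 + 0      ∎
    extension {b = b} _ cr s (no _) (yes oaz) (no _) (no ¬o) = ⊥-elim (¬o (occ-++ˡ [ b ] oaz))
    extension _ cr s (no _) (yes _) (no ¬ozb) (yes _) =
      cong (_+ (χ s + 0 + 0)) (χ-false cr (λ y → ¬ozb (proj₂ (proj₂ (proj₂ (to CR-letters y))))))

    letterwise : ∀ a z → m ≤ length z →
      ∑ as (λ b → χ (CR? (a ∷ (z ∷ʳ b)))) + ∑ as (λ b → α (z ∷ʳ b) * (β (a ∷ (z ∷ʳ b)) * χ (S? (a ∷ (z ∷ʳ b)))))
        ≡ α z * (β (a ∷ z) * χ (S? (a ∷ z))) + α z * (β (a ∷ z) * ρ (a ∷ z))
    letterwise a z m≤z = begin
      ∑ as (λ b → χ (CR? (a ∷ (z ∷ʳ b)))) + ∑ as (λ b → α (z ∷ʳ b) * (β (a ∷ (z ∷ʳ b)) * χ (S? (a ∷ (z ∷ʳ b)))))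
        ≡⟨ ∑-+ as _ _ ⟨
      ∑ as (λ b → χ (CR? (a ∷ (z ∷ʳ b))) + α (z ∷ʳ b) * (β (a ∷ (z ∷ʳ b)) * χ (S? (a ∷ (z ∷ʳ b)))))
        ≡⟨ ∑-cong as (λ {b} _ → extension m≤z (CR? (a ∷ (z ∷ʳ b))) (S? (a ∷ (z ∷ʳ b))) (Occ? z)
                                    (Occ? (a ∷ z)) (Occ? (z ∷ʳ b)) (Occ? (a ∷ (z ∷ʳ b)))) ⟩
      ∑ as (λ b → α z * (β (a ∷ z) * χ (S? (a ∷ (z ∷ʳ b)))))
        ≡⟨ trans (∑-* as (α z) _) (cong (α z *_) (∑-* as (β (a ∷ z)) _)) ⟩
      α z * (β (a ∷ z) * r (a ∷ z))
        ≡⟨ cong (λ t → α z * (β (a ∷ z) * t)) (χ+ρ≡r (a ∷ z)) ⟨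
      α z * (β (a ∷ z) * (χ (S? (a ∷ z)) + ρ (a ∷ z)))
        ≡⟨ trans (cong (α z *_) (*-distribˡ-+ (β (a ∷ z)) _ _)) (*-distribˡ-+ (α z) _ _) ⟩
      α z * (β (a ∷ z) * χ (S? (a ∷ z))) + α z * (β (a ∷ z) * ρ (a ∷ z)) ∎

  -- Words of length at most `m` are too short to meet `X`.
  σ-below : ∀ n → n < m → σ n ≡ 0
  σ-below n n<m = ∑∑-zero n λ {z} a z≡n →
    trans (cong (λ t → α z * (t * ρ (a ∷ z)))
            (χ-false (Occ? (a ∷ z)) (λ o → <-irrefl refl (≤-trans (s≤s n<m) (subst (m <_) (cong suc z≡n) (occ-length o))))))
          (*-zeroʳ (α z))

  -- The base is the total weight of the letters, which no level below `m` diminishes.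
  τ-below : ∀ n → n ≤ m → τ n + 2 ≡ length as
  τ-below zero    _   = begin
    α [] * ∑ as (λ a → ρ [ a ]) + 0 + 2  ≡⟨ cong (_+ 2) (+-identityʳ _) ⟩
    α [] * ∑ as (λ a → ρ [ a ]) + 2      ≡⟨ cong (_+ 2) (*-identityˡ _) ⟩
    ∑ as (λ a → ρ [ a ]) + 2             ≡⟨ ρ-letters ⟩
    length as                            ∎
    where open ≡-Reasoning
  τ-below (suc n) n<m = trans
    (cong (_+ 2) (sym (trans (τ-step n) (cong (_+ τ (suc n)) (σ-below n n<m)))))
    (τ-below n (<⇒≤ n<m))

  -- The U-words of length `suc m` are the words of `X` themselves, the roots of the forest.
  μ-base : μ m ≡ c
  μ-base = begin
    μ m                                          ≡⟨ ∑∑-cong m (λ {z} a z≡m → weight z≡m (Occ? z) (Occ? (a ∷ z)) (S? (a ∷ z)) (X? (a ∷ z))) ⟩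
    ∑ (W m) (λ z → ∑ as (λ a → χ (X? (a ∷ z))))  ≡⟨ ∑-words-∷ as m (χ ∘ X?) ⟨
    ∑ (W (suc m)) (χ ∘ X?)                       ≡⟨ ∑-χ X? (W (suc m)) (words! as as! (suc m)) (λ {x} Xx → ∈-W x (X-length Xx)) X-card ⟩
    c                                            ∎
    where
    open ≡-Reasoning

    whole : ∀ {v} → length v ≡ suc m → Occ v → X v
    whole {v} v≡ (x , Xx , p , q , refl) = subst X (sym v≡x) Xx
      where
      p+q≡0 : length p + length q ≡ 0
      p+q≡0 = +-cancelˡ-≡ (length x) _ _ (begin
        length x + (length p + length q)   ≡⟨ x∙yz≈y∙xz (length x) (length p) (length q) ⟩
        length p + (length x + length q)   ≡⟨ cong (length p +_) (length-++ x) ⟨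
        length p + length (x ++ q)         ≡⟨ length-++ p ⟨
        length (p ++ x ++ q)               ≡⟨ trans v≡ (sym (X-length Xx)) ⟩
        length x                           ≡⟨ +-identityʳ _ ⟨
        length x + 0                       ∎)

      empty : ∀ (u : Word A) → length u ≡ 0 → u ≡ []
      empty [] _ = refl

      v≡x : p ++ x ++ q ≡ x
      v≡x = trans (cong₂ (λ s t → s ++ x ++ t) (empty p (m+n≡0⇒m≡0 (length p) p+q≡0)) (empty q (m+n≡0⇒n≡0 (length p) p+q≡0)))
                  (++-identityʳ x)

    weight : ∀ {a z} → length z ≡ m →
      (oz : Dec (Occ z)) (oaz : Dec (Occ (a ∷ z))) (s : Dec (S (a ∷ z))) (xaz : Dec (X (a ∷ z))) →
      (1 ∸ χ oz) * (χ oaz * χ s) ≡ χ xaz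
    weight z≡m (yes oz) oaz s xaz = ⊥-elim (<-irrefl (sym z≡m) (occ-length oz))
    weight z≡m (no _) (no ¬oaz) s xaz = sym (χ-false xaz (¬oaz ∘ X⇒occ))
    weight z≡m (no _) (yes oaz) s xaz = let Xaz = whole (cong suc z≡m) oaz in
      trans (cong (λ t → t + 0 + 0) (χ-true s (X⊆S Xaz))) (sym (χ-true xaz Xaz))

  -- Finiteness of the set of U-words.

  weight-U : ∀ {a z} → U a z → ∀ x → α z * (β (a ∷ z) * x) ≡ x
  weight-U {a} {z} (_ , ¬oz , oaz) x
    rewrite χ-false (Occ? z) ¬oz | χ-true (Occ? (a ∷ z)) oaz = trans (+-identityʳ _) (+-identityʳ _)

  -- The bound `d` is uniform over the level, so that it can serve as a decreasing measure in
  -- `search`.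
  Escape : ℕ → ℕ → Set
  Escape d n = ∀ a z → length z ≡ n → U a z → ∃[ v ] length v ≤ d × S (a ∷ (z ++ v)) × ¬ U a (z ++ v)

  -- Recurrence continues each U-word to an occurrence of `x₀` in its tail, which ends membership in
  -- `U`; a level has finitely many words, so one bound suffices.
  escape : ∀ n → ∃[ d ] Escape d n
  escape n =
    let d , esc = common-bound {Q = Q} (λ d≤e q u → let v , v≤d , rest = q u in v , ≤-trans v≤d d≤e , rest)
                               bound (cartesianProduct as (W n))
    in d , λ a z z≡n → esc (∈-cartesianProduct⁺ (as∋ a) (∈-W z z≡n))
    where
    Q : A × Word A → ℕ → Set
    Q (a , z) d = U a z → ∃[ v ] length v ≤ d × S (a ∷ (z ++ v)) × ¬ U a (z ++ v)

    bound : ∀ x → ∃[ d ] Q x d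
    bound (a , z) with U? a z
    ... | no ¬u = 0 , λ u → ⊥-elim (¬u u)
    ... | yes u = let v , _ , Sy = recur (proj₁ u) (X⊆S x₀∈X) in
      length (v ++ x₀) , λ _ → v ++ x₀ , ≤-refl , Sy ,
        λ u′ → proj₁ (proj₂ u′) (occ-++ʳ z (occ-++ʳ v (X⇒occ x₀∈X)))

  -- A vanishing sum of natural numbers has only zero terms, so the U-word has weight 0 and a single
  -- right extension.
  forced : ∀ {a z b d} → σ (length z) ≡ 0 → U a z → S (a ∷ (z ∷ʳ b)) → S (a ∷ (z ∷ʳ d)) → b ≡ d
  forced {a} {z} σ≡0 u Sb Sd = ∑-χ≤1⇒unique (λ b → S? (a ∷ (z ∷ʳ b))) r≤1 (as∋ _) (as∋ _) Sb Sd
    where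
    ρ≡0 : ρ (a ∷ z) ≡ 0
    ρ≡0 = trans (sym (weight-U u _)) (∑≡0⇒≡0 (∑≡0⇒≡0 σ≡0 (∈-W z refl)) (as∋ a))

    r≤1 : r (a ∷ z) ≤ 1
    r≤1 = ≤-reflexive (trans (sym (χ+ρ≡r (a ∷ z))) (cong₂ _+_ (χ-true (S? (a ∷ z)) (proj₁ u)) ρ≡0))

  NoU : ℕ → Set
  NoU n = ∀ a z → length z ≡ n → ¬ U a z

  -- The escape of the parent `a ∷ z` must begin with the only possible letter `b`; dropping it
  -- leaves an escape of the child.
  escape-step : ∀ {d n} → m ≤ n → σ n ≡ 0 → Escape (suc d) n → Escape d (suc n)
  escape-step {d} {n} m≤n σ≡0 esc a y y≡1+n u with initLast y
  ... | z ∷ʳ′ b = next (esc a z z≡n uz)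
    where
    z≡n = suc-injective (trans (sym (length-∷ʳ z b)) y≡1+n)
    uz  = U-init (subst (m ≤_) (sym z≡n) m≤n) u

    next : ∃[ v ] length v ≤ suc d × S (a ∷ (z ++ v)) × ¬ U a (z ++ v) →
           ∃[ v ] length v ≤ d × S (a ∷ (z ∷ʳ b ++ v)) × ¬ U a (z ∷ʳ b ++ v)
    next ([] , _ , _ , ¬u) = ⊥-elim (¬u (subst (U a) (sym (++-identityʳ z)) uz))
    next (b′ ∷ v , s≤s v≤d , Sy , ¬u)
      with forced (trans (cong σ z≡n) σ≡0) uz (proj₁ u)
             (S-prefix v (subst (S ∘ (a ∷_)) (sym (∷ʳ-++ z b′ v)) Sy))
    ... | refl = v , v≤d , subst (S ∘ (a ∷_)) (sym (∷ʳ-++ z b v)) Sy , ¬u ∘ subst (U a) (∷ʳ-++ z b v)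

  -- When σ n ≡ 0 the U-words of level n have a single right extension, so the escape of each of them
  -- provided by recurrence is forced and gets shorter at the next level; when σ n > 0 the weight τ drops.
  find   : ∀ t n → m ≤ n → τ n ≤ t → ∃[ d ] NoU (d + m)
  search : ∀ t d n → m ≤ n → τ n ≤ t → Escape d n → ∃[ d ] NoU (d + m)

  find t n m≤n τ≤t = let d , esc = escape n in search t d n m≤n τ≤t esc

  search t d n m≤n τ≤t esc with σ n in eq
  search zero d n m≤n τ≤t esc | suc s = ⊥-elim (n≮0 (subst (_≤ 0) (trans (τ-step n) (cong (_+ τ (suc n)) eq)) τ≤t))
  search (suc t) d n m≤n τ≤t esc | suc s = find t (suc n) (m≤n⇒m≤1+n m≤n)
    (≤-trans (m≤n+m _ s) (≤-pred (subst (_≤ suc t) (trans (τ-step n) (cong (_+ τ (suc n)) eq)) τ≤t)))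
  search t zero n m≤n τ≤t esc | zero = n ∸ m , subst NoU (sym (m∸n+n≡m m≤n)) noU
    where
    noU : NoU n
    noU a z z≡n u with esc a z z≡n u
    ... | [] , _ , _ , ¬u = ¬u (subst (U a) (sym (++-identityʳ z)) u)
  search t (suc d) n m≤n τ≤t esc | zero = search t d (suc n) (m≤n⇒m≤1+n m≤n)
    (subst (_≤ t) (trans (τ-step n) (cong (_+ τ (suc n)) eq)) τ≤t) (escape-step m≤n eq esc)

  -- Cutting the tail of a longer U-word to length `n` would give a U-word of level `n`.
  NoU-above : ∀ {n} → m ≤ n → NoU n → ∀ {a z} → n ≤ length z → ¬ U a z
  NoU-above {n} m≤n noU {a} {z} n≤z u = noU a (take n z) len
    (U-prefix (drop n z) (subst (m ≤_) (sym len) m≤n) (subst (U a) (sym (take++drop≡id n z)) u))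
    where
    len : length (take n z) ≡ n
    len = trans (length-take n z) (m≤n⇒m⊓n≡m n≤z)

  -- Without U-words from level n on, a word avoiding X avoids it in all its left extensions,
  -- against recurrence.
  τ-zero : ∀ {n} → m ≤ n → NoU n → τ n ≡ 0
  τ-zero {n} m≤n noU = trans (∑-cong (W n) (λ {z} z∈ → vanish z (W-length n z∈))) (∑-zero (W n))
    where
    left-avoid : ∀ {z a} p → n ≤ length z → ¬ Occ (a ∷ z) → S (p ++ a ∷ z) → ¬ Occ (p ++ a ∷ z)
    left-avoid []      n≤z ¬o Sy o = ¬o o
    left-avoid {z} {a} (b ∷ p) n≤z ¬o Sy o = NoU-above m≤n noU
      (≤-trans n≤z (≤-trans (n≤1+n _) (≤-trans (m≤n+m _ (length p)) (≤-reflexive (sym (length-++ p))))))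
      (Sy , left-avoid p n≤z ¬o (S-tail Sy) , o)

    ρ≡0 : ∀ {z} a → length z ≡ n → ¬ Occ z → ρ (a ∷ z) ≡ 0
    ρ≡0 {z} a z≡n ¬oz with S? (a ∷ z)
    ... | no ¬Saz = ρ-∉ ¬Saz
    ... | yes Saz with recur (X⊆S x₀∈X) Saz
    ...   | v , _ , Sy = ⊥-elim (left-avoid (x₀ ++ v) (≤-reflexive (sym z≡n))
              (λ o → noU a z z≡n (Saz , ¬oz , o))
              (subst S (sym (++-assoc x₀ v (a ∷ z))) Sy)
              (occ-++ˡ (a ∷ z) (occ-++ˡ v (X⇒occ x₀∈X))))

    vanish : ∀ z → length z ≡ n → α z * ∑ as (λ a → ρ (a ∷ z)) ≡ 0
    vanish z z≡n with Occ? z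
    ... | yes _  = refl
    ... | no ¬oz = trans (*-identityˡ _) (trans (∑-cong as (λ {a} _ → ρ≡0 a z≡n ¬oz)) (∑-zero as))

  μ-zero : ∀ {n} → NoU n → μ n ≡ 0
  μ-zero {n} noU = ∑∑-zero n (λ {z} a z≡n → vanish (noU a z z≡n) (Occ? z) (Occ? (a ∷ z)) (S? (a ∷ z)))
    where
    vanish : ∀ {a z} → ¬ U a z → (oz : Dec (Occ z)) (oaz : Dec (Occ (a ∷ z))) (s : Dec (S (a ∷ z))) →
             (1 ∸ χ oz) * (χ oaz * χ s) ≡ 0
    vanish ¬u (yes _)  oaz       s        = refl
    vanish ¬u (no _)   (no _)    s        = refl
    vanish ¬u (no _)   (yes _)   (no _)   = refl
    vanish ¬u (no ¬oz) (yes oaz) (yes Sy) = ⊥-elim (¬u (Sy , ¬oz , oaz))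

  -- Enumeration of the complete return words by length.

  returns : ℕ → List (Word A)
  returns zero    = []
  -- Lengths start at `2 + m`, the least possible by `CR-length`.
  returns (suc d) = filter CR? (W (2 + (d + m))) ++ returns d

  returns-CR : ∀ d {y} → y ∈ returns d → CR y
  returns-CR (suc d) y∈ with ∈-++⁻ (filter CR? (W (2 + (d + m)))) y∈
  ... | inj₁ i = proj₂ (∈-filter⁻ CR? {xs = W (2 + (d + m))} i)
  ... | inj₂ j = returns-CR d j

  returns-length : ∀ d {y} → y ∈ returns d → length y < 2 + (d + m)
  returns-length (suc d) y∈ with ∈-++⁻ (filter CR? (W (2 + (d + m)))) y∈
  ... | inj₁ i = ≤-reflexive (cong suc (W-length (2 + (d + m)) (proj₁ (∈-filter⁻ CR? {xs = W (2 + (d + m))} i))))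
  ... | inj₂ j = m≤n⇒m≤1+n (returns-length d j)

  returns-complete : ∀ d {y} → CR y → length y < 2 + (d + m) → y ∈ returns d
  returns-complete zero    cr y< = ⊥-elim (<-irrefl refl (≤-trans y< (CR-length cr)))
  returns-complete (suc d) {y} cr (s≤s y≤) with m≤n⇒m<n∨m≡n y≤
  ... | inj₁ y<  = ∈-++⁺ʳ _ (returns-complete d cr y<)
  ... | inj₂ y≡  = ∈-++⁺ˡ (∈-filter⁺ CR? (∈-W y y≡) cr)

  returns! : ∀ d → Unique (returns d)
  returns! zero    = []
  returns! (suc d) = ++⁺ (filter⁺ CR? (words! as as! (2 + (d + m)))) (returns! d)
    λ (i , j) → <-irrefl (W-length (2 + (d + m)) (proj₁ (∈-filter⁻ CR? {xs = W (2 + (d + m))} i))) (returns-length d j)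

  -- Leaves already found, U-words still open and weight still unspent have a constant total, by
  -- `returns-step` and `τ-step`. At the start there are no leaves, `c` roots and weight `length as`
  -- - 2.
  returns-invariant : ∀ d → length (returns d) + (μ (d + m) + τ (d + m)) + 2 ≡ c + length as
  returns-invariant zero    = trans (+-assoc (μ m) (τ m) 2) (cong₂ _+_ μ-base (τ-below m ≤-refl))
  returns-invariant (suc d) = trans (cong (_+ 2) (begin
      length (returns (suc d)) + (μ (suc n) + τ (suc n))     ≡⟨ cong (_+ (μ (suc n) + τ (suc n))) len ⟩
      C + K + (μ (suc n) + τ (suc n))                        ≡⟨ cong (_+ (μ (suc n) + τ (suc n))) (+-comm C K) ⟩
      K + C + (μ (suc n) + τ (suc n))                        ≡⟨ +-assoc K C _ ⟩
      K + (C + (μ (suc n) + τ (suc n)))                      ≡⟨ cong (K +_) (+-assoc C (μ (suc n)) (τ (suc n))) ⟨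
      K + (C + μ (suc n) + τ (suc n))                        ≡⟨ cong (λ t → K + (t + τ (suc n))) (returns-step n (m≤n+m m d)) ⟩
      K + (μ n + σ n + τ (suc n))                            ≡⟨ cong (K +_) (+-assoc (μ n) (σ n) _) ⟩
      K + (μ n + (σ n + τ (suc n)))                          ≡⟨ cong (λ t → K + (μ n + t)) (τ-step n) ⟨
      K + (μ n + τ n)                                        ∎)) (returns-invariant d)
    where
    open ≡-Reasoning
    n = d + m
    K = length (returns d)
    C = ∑ (W (2 + n)) (χ ∘ CR?)

    len : length (returns (suc d)) ≡ C + K
    len = trans (length-++ (filter CR? (W (2 + n)))) (cong (_+ K) (length-filter-∑ CR? (W (2 + n))))

  -- Dropping the last letter of a complete return word leaves a U-word, whose tail is shorter than
  -- `n`.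
  CR-short : ∀ {n} → m ≤ n → NoU n → ∀ {y} → CR y → length y < 2 + n
  CR-short m≤n noU {[]}    cr = s≤s z≤n
  CR-short m≤n noU {a ∷ v} cr with initLast v
  ... | []      = s≤s (s≤s z≤n)
  ... | z ∷ʳ′ b = s≤s (subst (_< _) (sym (length-∷ʳ z b)) (s≤s (≰⇒> λ n≤z →
        let Sy , ¬oz , oaz , _ = to CR-letters cr
        in NoU-above m≤n noU n≤z (S-prefix [ b ] Sy , ¬oz , oaz))))

  -- At a level without U-words the terms `μ` and `τ` of the invariant vanish, and the list of
  -- leaves is complete.
  complete-returns-cardinality : ∃[ n ] HasCardinality CR n × n + 2 ≡ c + length as
  complete-returns-cardinality =
    let d , noU = find (τ m) m ≤-refl ≤-refl
        m≤      = m≤n+m m d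
    in length (returns d)
     , (returns d , returns! d , refl , λ y → mk⇔ (returns-CR d) (λ cr → returns-complete d cr (CR-short m≤ noU cr)))
     , trans (cong (_+ 2) (sym (trans (cong (length (returns d) +_) (cong₂ _+_ (μ-zero noU) (τ-zero m≤ noU))) (+-identityʳ _))))
             (returns-invariant d)

-- The pair formed by a word and its inverse in a specular set.

theorem6p9 : {A : Set} {k : ℕ} → A ↔ Fin k →
    (θ : A → A) → (∀ a → θ (θ a) ≡ a) →
    (S : Language A) → Specular θ S → Recurrent S →
    (w : Word A) → S w → w ≢ inverse θ w →
    HasCardinality (CompleteReturnWord S (｛ w ｝ ∪ ｛ inverse θ w ｝)) k
-- The empty word is its own inverse.
theorem6p9 iso θ θθ S spec rec [] Sw w≢w⁻¹ = ⊥-elim (w≢w⁻¹ refl)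
theorem6p9 {A} {k} iso θ θθ S spec rec w@(a ∷ z) Sw w≢w⁻¹ =
  let n , card , n+2≡2+k = complete-returns-cardinality
  -- The two roots cancel the 2 that comes from the characteristic.
  in subst (HasCardinality _) (+-cancelʳ-≡ 2 n k (trans n+2≡2+k (trans (cong (2 +_) as-length) (+-comm 2 k)))) card
  where
  open Specular spec

  as : List A
  as = map (Inverse.from iso) (allFin k)

  as-length : length as ≡ k
  as-length = trans (length-map (Inverse.from iso) (allFin k)) (length-tabulate id)

  as! : Unique as
  as! = map⁺ (λ {i} {j} eq → trans (sym (Inverse.strictlyInverseˡ iso i))
               (trans (cong (Inverse.to iso) eq) (Inverse.strictlyInverseˡ iso j))) (allFin⁺ k)

  as∋ : ∀ b → b ∈ as
  as∋ b = subst (_∈ as) (Inverse.strictlyInverseʳ iso b) (∈-map⁺ (Inverse.from iso) (∈-allFin (Inverse.to iso b)))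

  X : Language A
  X = ｛ w ｝ ∪ ｛ inverse θ w ｝

  X-card : HasCardinality X 2
  X-card = w ∷ inverse θ w ∷ [] , (w≢w⁻¹ ∷ []) ∷ [] ∷ [] , refl , λ _ → mk⇔
    (λ { (here eq) → inj₁ (sym eq) ; (there (here eq)) → inj₂ (sym eq) })
    (λ { (inj₁ eq) → here (sym eq) ; (inj₂ eq) → there (here (sym eq)) })

  X⊆S : ∀ {x} → X x → S x
  X⊆S (inj₁ refl) = Sw
  X⊆S (inj₂ refl) = Laminary.inverse-closed laminary Sw

  X-length : ∀ {x} → X x → length x ≡ length w
  X-length (inj₁ refl) = refl
  X-length (inj₂ refl) = trans (length-reverse (map θ w)) (length-map θ w)

  -- As `w` is `a ∷ z`, the common length is `suc m` with `m` equal to `length z`.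
  open ReturnWords (via-injection (↔⇒↣ iso) Fin._≟_) as as! as∋ S treeSet rec
                   X (length z) 2 X-card X⊆S X-length w (inj₁ refl)
    using (complete-returns-cardinality)
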